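{- Let $P\in N_1$ be a sum of $6$ monomials, not necessarily distinct (i.e. $P(1)=6$). If $P$ does not have unique factorisation inside $N_1$, then $P=X^a(1+X^b+X^{2b}+X^{3b}+X^{4b}+X^{5b})$ for some integers $a\ge0$ and $b\ge1$.
   Context: $N_1=\mathbb{Z}_{\ge0}[X]$ is the semiring of univariate polynomials with nonnegative integer coefficients. An element $Q\neq0,1$ of $N_1$ is irreducible if in every factorisation $Q=ST$ with $S,T\in N_1$ one of $S,T$ is $1$. $P$ has unique factorisation in $N_1$ if any two factorisations of $P$ into irreducibles of $N_1$ coincide up to order of the factors. -}

module Defs where

open import Algebra.Bundles using (RawSemiring)
import Algebra.Definitions.RawSemiring as RawSemiringDefs
open import Data.List.Base using (List; []; _∷_; foldr; map)
open import Data.List.Relation.Unary.All using (All)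
import Data.List.Relation.Binary.Permutation.Setoid as Permutation
open import Data.Nat.Base as ℕ using (ℕ; zero; suc)
open import Data.Product.Base using (_×_)
open import Data.Sum.Base using (_⊎_)
open import Level using (0ℓ)
open import Relation.Binary.Bundles using (Setoid)
open import Relation.Binary.PropositionalEquality using (_≗_; refl; sym; trans)
open import Relation.Nullary.Negation.Core using (¬_)

infix  4 _≈_
infixl 6 _+_
infixl 7 _*_

-- a₀ ∷ a₁ ∷ … ∷ aₖ ∷ [] stands for a₀ + a₁X + … + aₖXᵏ.  Trailing zeros are
-- allowed, so equality of polynomials is _≈_ below, not _≡_.
N₁ : Set
N₁ = List ℕ

coeff : N₁ → ℕ → ℕ
coeff []      n       = 0
coeff (a ∷ p) zero    = a
coeff (a ∷ p) (suc n) = coeff p n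

-- A record rather than a function type, so that p and q can be inferred from
-- a proof of p ≈ q.
record _≈_ (p q : N₁) : Set where
  constructor mk≈
  field
    coeff≗ : coeff p ≗ coeff q

open _≈_ public

N₁-setoid : Setoid 0ℓ 0ℓ
N₁-setoid = record
  { Carrier       = N₁
  ; _≈_           = _≈_
  ; isEquivalence = record
    { refl  = mk≈ λ _ → refl
    ; sym   = λ p≈q → mk≈ λ n → sym (coeff≗ p≈q n)
    ; trans = λ p≈q q≈r → mk≈ λ n → trans (coeff≗ p≈q n) (coeff≗ q≈r n)
    }
  }

0# : N₁
0# = []

1# : N₁
1# = 1 ∷ []

X : N₁
X = 0 ∷ 1 ∷ []

_+_ : N₁ → N₁ → N₁
[]      + q       = q
(a ∷ p) + []      = a ∷ p
(a ∷ p) + (b ∷ q) = (a ℕ.+ b) ∷ (p + q)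

-- (a + X p) q = a q + X (p q)
_*_ : N₁ → N₁ → N₁
[]      * q = []
(a ∷ p) * q = map (a ℕ.*_) q + (0 ∷ (p * q))

N₁-rawSemiring : RawSemiring 0ℓ 0ℓ
N₁-rawSemiring = record
  { Carrier = N₁
  ; _≈_     = _≈_
  ; _+_     = _+_
  ; _*_     = _*_
  ; 0#      = 0#
  ; 1#      = 1#
  }

open RawSemiringDefs N₁-rawSemiring public using (_^_)
open Permutation N₁-setoid public using (_↭_)

eval : N₁ → ℕ → ℕ
eval []      x = 0
eval (a ∷ p) x = a ℕ.+ x ℕ.* eval p x

Irreducible : N₁ → Set
Irreducible Q =
  ¬ (Q ≈ 0#) × ¬ (Q ≈ 1#) ×
  (∀ S T → Q ≈ S * T → S ≈ 1# ⊎ T ≈ 1#)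

product : List N₁ → N₁
product = foldr _*_ 1#

IsFactorisation : N₁ → List N₁ → Set
IsFactorisation P Qs = All Irreducible Qs × P ≈ product Qs

-- _↭_ is permutation up to _≈_ of the entries.
HasUniqueFactorisation : N₁ → Set
HasUniqueFactorisation P =
  ∀ Qs Rs → IsFactorisation P Qs → IsFactorisation P Rs → Qs ↭ Rs

{-# OPTIONS --safe #-}
module Submission where

-- A sum of six monomials with nonzero constant term is either irreducible or a
-- product (1 + Xⁱ)(1 + Xᵏ + Xˡ), since the values at 1 of the factors multiply
-- to 6.  Two such products agree iff the multisets of their six exponents do;
-- matching the smallest exponents, the largest ones and the exponent i forces
-- the factors to agree, up to the identity
-- (1 + X)(1 + X² + X⁴) = (1 + X³)(1 + X + X²) and its substitutions X ↦ Xᵇ.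
-- Powers of X split off uniquely.  Equality with some 1 + Xᵇ + … + X⁵ᵇ is
-- decidable, so the negated hypothesis still yields the exponents a and b.

open import Defs
open import Algebra.Bundles using (CommutativeMonoid; CommutativeSemiring)
open import Algebra.Structures {A = N₁} _≈_ using (IsCommutativeMonoid)
open import Algebra.Structures.Biased {A = N₁} _≈_
  using (isCommutativeMonoidˡ; isCommutativeSemiringˡ)
import Algebra.Properties.CommutativeSemigroup as CommutativeSemigroupProperties
import Algebra.Properties.Semiring.Exp as Exp
open import Data.List.Base
  using (List; []; _∷_; [_]; _++_; length; map; replicate; cartesianProductWith)
import Data.List.Properties as List
open import Data.List.Membership.Propositional using (_∈_; lose)
open import Data.List.Membership.Propositional.Properties using (∈-∃++)
open import Data.List.Relation.Binary.Permutation.Propositional as Perm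
  using () renaming (_↭_ to _↭ℕ_)
import Data.List.Relation.Binary.Permutation.Propositional.Properties as Perm
import Data.List.Relation.Binary.Permutation.Setoid as SetoidPerm
import Data.List.Relation.Binary.Permutation.Setoid.Properties as SetoidPerm
open import Data.List.Relation.Unary.All using (All; []; _∷_)
open import Data.List.Relation.Unary.Any using (here; there; any?; satisfied)
open import Data.Nat.Base as ℕ using (ℕ; zero; suc; s≤s; z≤n)
import Data.Nat.Properties as ℕ
open import Data.Product.Base using (∃-syntax; _×_; _,_; proj₁; proj₂; uncurry)
open import Data.Sum.Base using (_⊎_; inj₁; inj₂)
open import Level using (0ℓ)
open import Relation.Binary.Bundles using (Setoid)
open import Relation.Binary.Definitions using (Tri; tri<; tri≈; tri>)
open import Relation.Binary.PropositionalEquality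
  using (_≡_; _≢_; refl; sym; trans; cong; cong₂; subst; module ≡-Reasoning)
import Relation.Binary.Reasoning.Setoid as SetoidReasoning
open import Relation.Nullary.Decidable.Core using (Dec; yes; no; map′; _×-dec_)
open import Relation.Nullary.Negation.Core using (¬_; contradiction)

open Setoid N₁-setoid
  using () renaming (refl to ≈-refl; sym to ≈-sym; trans to ≈-trans)

private
  module ℕ+ = CommutativeSemigroupProperties ℕ.+-commutativeSemigroup
  module ℕ* = CommutativeSemigroupProperties ℕ.*-commutativeSemigroup

-- The semiring laws

infixl 7 _·_

_·_ : ℕ → N₁ → N₁
a · p = map (a ℕ.*_) p

coeff-+ : ∀ p q n → coeff (p + q) n ≡ coeff p n ℕ.+ coeff q n
coeff-+ []      q       n       = refl
coeff-+ (a ∷ p) []      n       = sym (ℕ.+-identityʳ _)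
coeff-+ (a ∷ p) (b ∷ q) zero    = refl
coeff-+ (a ∷ p) (b ∷ q) (suc n) = coeff-+ p q n

coeff-· : ∀ a p n → coeff (a · p) n ≡ a ℕ.* coeff p n
coeff-· a []      n       = sym (ℕ.*-zeroʳ a)
coeff-· a (b ∷ p) zero    = refl
coeff-· a (b ∷ p) (suc n) = coeff-· a p n

∷-cong : ∀ {a b p q} → a ≡ b → p ≈ q → a ∷ p ≈ b ∷ q
∷-cong a≡b p≈q = mk≈ λ { zero → a≡b ; (suc n) → coeff≗ p≈q n }

∷-injectiveʳ : ∀ {a b p q} → a ∷ p ≈ b ∷ q → p ≈ q
∷-injectiveʳ eq = mk≈ λ n → coeff≗ eq (suc n)

0∷[]≈0# : 0 ∷ [] ≈ 0#
0∷[]≈0# = mk≈ λ { zero → refl ; (suc n) → refl }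

+-cong : ∀ {p p′ q q′} → p ≈ p′ → q ≈ q′ → p + q ≈ p′ + q′
+-cong {p} {p′} {q} {q′} p≈p′ q≈q′ = mk≈ λ n → begin
  coeff (p + q) n            ≡⟨ coeff-+ p q n ⟩
  coeff p n ℕ.+ coeff q n    ≡⟨ cong₂ ℕ._+_ (coeff≗ p≈p′ n) (coeff≗ q≈q′ n) ⟩
  coeff p′ n ℕ.+ coeff q′ n  ≡⟨ coeff-+ p′ q′ n ⟨
  coeff (p′ + q′) n          ∎
  where open ≡-Reasoning

+-assoc : ∀ p q r → (p + q) + r ≈ p + (q + r)
+-assoc []      q       r       = ≈-refl
+-assoc (a ∷ p) []      r       = ≈-refl
+-assoc (a ∷ p) (b ∷ q) []      = ≈-refl
+-assoc (a ∷ p) (b ∷ q) (c ∷ r) = ∷-cong (ℕ.+-assoc a b c) (+-assoc p q r)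

+-comm : ∀ p q → p + q ≈ q + p
+-comm []      []      = ≈-refl
+-comm []      (b ∷ q) = ≈-refl
+-comm (a ∷ p) []      = ≈-refl
+-comm (a ∷ p) (b ∷ q) = ∷-cong (ℕ.+-comm a b) (+-comm p q)

+-isCommutativeMonoid : IsCommutativeMonoid _+_ 0#
+-isCommutativeMonoid = isCommutativeMonoidˡ record
  { isSemigroup = record
    { isMagma = record
      { isEquivalence = Setoid.isEquivalence N₁-setoid
      ; ∙-cong        = +-cong
      }
    ; assoc = +-assoc
    }
  ; identityˡ = λ _ → ≈-refl
  ; comm      = +-comm
  }

+-commutativeMonoid : CommutativeMonoid 0ℓ 0ℓ
+-commutativeMonoid = record { isCommutativeMonoid = +-isCommutativeMonoid }

open CommutativeSemigroupProperties
  (CommutativeMonoid.commutativeSemigroup +-commutativeMonoid)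
  using (interchange)

+-cancelˡ : ∀ p {q r} → p + q ≈ p + r → q ≈ r
+-cancelˡ p {q} {r} eq = mk≈ λ n → ℕ.+-cancelˡ-≡ (coeff p n) _ _ (begin
  coeff p n ℕ.+ coeff q n  ≡⟨ coeff-+ p q n ⟨
  coeff (p + q) n          ≡⟨ coeff≗ eq n ⟩
  coeff (p + r) n          ≡⟨ coeff-+ p r n ⟩
  coeff p n ℕ.+ coeff r n  ∎)
  where open ≡-Reasoning

·-cong : ∀ a {p q} → p ≈ q → a · p ≈ a · q
·-cong a {p} {q} p≈q = mk≈ λ n →
  trans (coeff-· a p n) (trans (cong (a ℕ.*_) (coeff≗ p≈q n)) (sym (coeff-· a q n)))

·-distribˡ-+ : ∀ a p q → a · (p + q) ≈ a · p + a · q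
·-distribˡ-+ a []      q       = ≈-refl
·-distribˡ-+ a (b ∷ p) []      = ≈-refl
·-distribˡ-+ a (b ∷ p) (c ∷ q) = ∷-cong (ℕ.*-distribˡ-+ a b c) (·-distribˡ-+ a p q)

·-distribʳ-+ : ∀ a b p → (a ℕ.+ b) · p ≈ a · p + b · p
·-distribʳ-+ a b []      = ≈-refl
·-distribʳ-+ a b (c ∷ p) = ∷-cong (ℕ.*-distribʳ-+ c a b) (·-distribʳ-+ a b p)

·-assoc : ∀ a b p → (a ℕ.* b) · p ≈ a · (b · p)
·-assoc a b []      = ≈-refl
·-assoc a b (c ∷ p) = ∷-cong (ℕ.*-assoc a b c) (·-assoc a b p)

0·p≈0# : ∀ p → 0 · p ≈ 0#
0·p≈0# []      = ≈-refl
0·p≈0# (a ∷ p) = ≈-trans (∷-cong refl (0·p≈0# p)) 0∷[]≈0#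

1·p≈p : ∀ p → 1 · p ≈ p
1·p≈p []      = ≈-refl
1·p≈p (a ∷ p) = ∷-cong (ℕ.*-identityˡ a) (1·p≈p p)

*-congˡ : ∀ p {q r} → q ≈ r → p * q ≈ p * r
*-congˡ []      q≈r = ≈-refl
*-congˡ (a ∷ p) q≈r = +-cong (·-cong a q≈r) (∷-cong refl (*-congˡ p q≈r))

*-zeroʳ : ∀ p → p * 0# ≈ 0#
*-zeroʳ []      = ≈-refl
*-zeroʳ (a ∷ p) = ≈-trans (∷-cong refl (*-zeroʳ p)) 0∷[]≈0#

-- Mirrors the defining recursion of `_*_` in the other argument; commutativity then follows by
-- induction on the left factor.
*-∷ʳ : ∀ p b q → p * (b ∷ q) ≈ b · p + (0 ∷ p * q)
*-∷ʳ []      b q = ≈-sym 0∷[]≈0#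
*-∷ʳ (a ∷ p) b q = ∷-cong (cong (ℕ._+ 0) (ℕ.*-comm a b)) (begin
  a · q + p * (b ∷ q)            ≈⟨ +-cong ≈-refl (*-∷ʳ p b q) ⟩
  a · q + (b · p + (0 ∷ p * q))  ≈⟨ +-assoc (a · q) (b · p) _ ⟨
  a · q + b · p + (0 ∷ p * q)    ≈⟨ +-cong (+-comm (a · q) (b · p)) ≈-refl ⟩
  b · p + a · q + (0 ∷ p * q)    ≈⟨ +-assoc (b · p) (a · q) _ ⟩
  b · p + (a · q + (0 ∷ p * q))  ∎)
  where open SetoidReasoning N₁-setoid

*-comm : ∀ p q → p * q ≈ q * p
*-comm []      q = ≈-sym (*-zeroʳ q)
*-comm (a ∷ p) q = begin
  a · q + (0 ∷ p * q)  ≈⟨ +-cong ≈-refl (∷-cong refl (*-comm p q)) ⟩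
  a · q + (0 ∷ q * p)  ≈⟨ *-∷ʳ q a p ⟨
  q * (a ∷ p)          ∎
  where open SetoidReasoning N₁-setoid

-- `_*_` recurses on the list of its left factor, and equal polynomials may be lists of different
-- lengths. So a change of the left factor is moved to the right by commutativity.
*-cong : ∀ {p p′ q q′} → p ≈ p′ → q ≈ q′ → p * q ≈ p′ * q′
*-cong {p} {p′} {q} {q′} p≈p′ q≈q′ = begin
  p * q    ≈⟨ *-congˡ p q≈q′ ⟩
  p * q′   ≈⟨ *-comm p q′ ⟩
  q′ * p   ≈⟨ *-congˡ q′ p≈p′ ⟩
  q′ * p′  ≈⟨ *-comm q′ p′ ⟩
  p′ * q′  ∎
  where open SetoidReasoning N₁-setoid

*-distribʳ-+ : ∀ r p q → (p + q) * r ≈ p * r + q * r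
*-distribʳ-+ r []      q       = ≈-refl
*-distribʳ-+ r (a ∷ p) []      =
  ≈-sym (CommutativeMonoid.identityʳ +-commutativeMonoid _)
*-distribʳ-+ r (a ∷ p) (b ∷ q) = begin
  (a ℕ.+ b) · r + (0 ∷ (p + q) * r)
    ≈⟨ +-cong (·-distribʳ-+ a b r) (∷-cong refl (*-distribʳ-+ r p q)) ⟩
  a · r + b · r + ((0 ∷ p * r) + (0 ∷ q * r))
    ≈⟨ interchange (a · r) (b · r) (0 ∷ p * r) (0 ∷ q * r) ⟩
  a · r + (0 ∷ p * r) + (b · r + (0 ∷ q * r))  ∎
  where open SetoidReasoning N₁-setoid

0∷-*ˡ : ∀ p q → (0 ∷ p) * q ≈ 0 ∷ p * q
0∷-*ˡ p q = +-cong (0·p≈0# q) ≈-refl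

·-*ˡ : ∀ a p q → (a · p) * q ≈ a · (p * q)
·-*ˡ a []      q = ≈-refl
·-*ˡ a (b ∷ p) q = begin
  (a ℕ.* b) · q + (0 ∷ (a · p) * q)
    ≈⟨ +-cong (·-assoc a b q) (∷-cong (sym (ℕ.*-zeroʳ a)) (·-*ˡ a p q)) ⟩
  a · (b · q) + a · (0 ∷ p * q)        ≈⟨ ·-distribˡ-+ a (b · q) (0 ∷ p * q) ⟨
  a · (b · q + (0 ∷ p * q))            ∎
  where open SetoidReasoning N₁-setoid

*-assoc : ∀ p q r → (p * q) * r ≈ p * (q * r)
*-assoc []      q r = ≈-refl
*-assoc (a ∷ p) q r = begin
  (a · q + (0 ∷ p * q)) * r          ≈⟨ *-distribʳ-+ r (a · q) (0 ∷ p * q) ⟩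
  (a · q) * r + (0 ∷ p * q) * r      ≈⟨ +-cong (·-*ˡ a q r) (0∷-*ˡ (p * q) r) ⟩
  a · (q * r) + (0 ∷ (p * q) * r)    ≈⟨ +-cong ≈-refl (∷-cong refl (*-assoc p q r)) ⟩
  a · (q * r) + (0 ∷ p * (q * r))    ∎
  where open SetoidReasoning N₁-setoid

*-identityˡ : ∀ p → 1# * p ≈ p
*-identityˡ p = begin
  1 · p + (0 ∷ [])  ≈⟨ +-cong (1·p≈p p) 0∷[]≈0# ⟩
  p + 0#            ≈⟨ CommutativeMonoid.identityʳ +-commutativeMonoid p ⟩
  p                 ∎
  where open SetoidReasoning N₁-setoid

*-isCommutativeMonoid : IsCommutativeMonoid _*_ 1#
*-isCommutativeMonoid = isCommutativeMonoidˡ record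
  { isSemigroup = record
    { isMagma = record
      { isEquivalence = Setoid.isEquivalence N₁-setoid
      ; ∙-cong        = *-cong
      }
    ; assoc = *-assoc
    }
  ; identityˡ = *-identityˡ
  ; comm      = *-comm
  }

N₁-commutativeSemiring : CommutativeSemiring 0ℓ 0ℓ
N₁-commutativeSemiring = record
  { isCommutativeSemiring = isCommutativeSemiringˡ record
    { +-isCommutativeMonoid = +-isCommutativeMonoid
    ; *-isCommutativeMonoid = *-isCommutativeMonoid
    ; distribʳ              = *-distribʳ-+
    ; zeroˡ                 = λ _ → ≈-refl
    }
  }

open Exp (CommutativeSemiring.semiring N₁-commutativeSemiring) using (^-homo-*)

product-[_] : ∀ Q → product [ Q ] ≈ Q
product-[ Q ] = CommutativeSemiring.*-identityʳ N₁-commutativeSemiring Q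

X*p≈0∷p : ∀ p → X * p ≈ 0 ∷ p
X*p≈0∷p p = ≈-trans (0∷-*ˡ 1# p) (∷-cong refl (*-identityˡ p))

-- Decidability of equality

infix 4 _≈?_

-- Trailing zeros are invisible to `_≈_`, so an exhausted list is padded to `0 ∷ []` and the
-- coefficientwise comparison goes on.
_≈?_ : ∀ p q → Dec (p ≈ q)
∷-≈? : ∀ a p b q → Dec (p ≈ q) → Dec (a ∷ p ≈ b ∷ q)
∷-≈? a p b q p≈?q = map′ (uncurry ∷-cong) (λ eq → coeff≗ eq 0 , ∷-injectiveʳ eq)
  ((a ℕ.≟ b) ×-dec p≈?q)

[]      ≈? []      = yes ≈-refl
[]      ≈? (b ∷ q) = map′ (≈-trans (≈-sym 0∷[]≈0#)) (≈-trans 0∷[]≈0#)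
                       (∷-≈? 0 [] b q ([] ≈? q))
(a ∷ p) ≈? []      = map′ (λ eq → ≈-trans eq 0∷[]≈0#) (λ eq → ≈-trans eq (≈-sym 0∷[]≈0#))
                       (∷-≈? a p 0 [] (p ≈? []))
(a ∷ p) ≈? (b ∷ q) = ∷-≈? a p b q (p ≈? q)

-- Polynomials as multisets of exponents

-- The list stands for a multiset: repetitions count as multiplicities, and `poly-↭` and
-- `poly-injective` show that exactly the order is forgotten.
poly : List ℕ → N₁
poly []       = 0#
poly (e ∷ es) = X ^ e + poly es

exponents : N₁ → List ℕ
exponents []      = []
exponents (a ∷ p) = replicate a 0 ++ map suc (exponents p)

poly-++ : ∀ es fs → poly (es ++ fs) ≈ poly es + poly fs
poly-++ []       fs = ≈-refl
poly-++ (e ∷ es) fs =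
  ≈-trans (+-cong ≈-refl (poly-++ es fs)) (≈-sym (+-assoc (X ^ e) (poly es) (poly fs)))

poly-map-+ : ∀ d es → poly (map (d ℕ.+_) es) ≈ X ^ d * poly es
poly-map-+ d []       = ≈-sym (*-zeroʳ (X ^ d))
poly-map-+ d (e ∷ es) = ≈-trans (+-cong (^-homo-* X d e) (poly-map-+ d es))
  (≈-sym (CommutativeSemiring.distribˡ N₁-commutativeSemiring (X ^ d) (X ^ e) (poly es)))

poly-* : ∀ es fs → poly es * poly fs ≈ poly (cartesianProductWith ℕ._+_ es fs)
poly-* []       fs = ≈-refl
poly-* (e ∷ es) fs = begin
  (X ^ e + poly es) * poly fs
    ≈⟨ *-distribʳ-+ (poly fs) (X ^ e) (poly es) ⟩
  X ^ e * poly fs + poly es * poly fs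
    ≈⟨ +-cong (≈-sym (poly-map-+ e fs)) (poly-* es fs) ⟩
  poly (map (e ℕ.+_) fs) + poly (cartesianProductWith _ es fs) ≈⟨ poly-++ (map (e ℕ.+_) fs) _ ⟨
  poly (cartesianProductWith ℕ._+_ (e ∷ es) fs)               ∎
  where open SetoidReasoning N₁-setoid

poly-replicate-0 : ∀ a → poly (replicate a 0) ≈ a ∷ []
poly-replicate-0 zero    = ≈-sym 0∷[]≈0#
poly-replicate-0 (suc a) = +-cong {1#} ≈-refl (poly-replicate-0 a)

poly-exponents : ∀ p → poly (exponents p) ≈ p
poly-exponents []      = ≈-refl
poly-exponents (a ∷ p) = begin
  poly (replicate a 0 ++ map suc (exponents p))
    ≈⟨ poly-++ (replicate a 0) (map suc (exponents p)) ⟩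
  poly (replicate a 0) + poly (map suc (exponents p))
    ≈⟨ +-cong (poly-replicate-0 a) (poly-map-+ 1 (exponents p)) ⟩
  (a ∷ []) + (X ^ 1 * poly (exponents p))
    ≈⟨ +-cong {a ∷ []} ≈-refl (*-cong product-[ X ] (poly-exponents p)) ⟩
  (a ∷ []) + X * p
    ≈⟨ +-cong {a ∷ []} ≈-refl (X*p≈0∷p p) ⟩
  a ℕ.+ 0 ∷ p
    ≈⟨ ∷-cong (ℕ.+-identityʳ a) ≈-refl ⟩
  a ∷ p ∎
  where open SetoidReasoning N₁-setoid

coeff-X^n-n : ∀ n → coeff (X ^ n) n ≡ 1
coeff-X^n-n zero    = refl
coeff-X^n-n (suc n) = trans (coeff≗ (X*p≈0∷p (X ^ n)) (suc n)) (coeff-X^n-n n)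

coeff-X^n-m≢0 : ∀ n m → coeff (X ^ n) m ≢ 0 → m ≡ n
coeff-X^n-m≢0 zero    zero    _  = refl
coeff-X^n-m≢0 zero    (suc m) ≢0 = contradiction refl ≢0
coeff-X^n-m≢0 (suc n) zero    ≢0 = contradiction (coeff≗ (X*p≈0∷p (X ^ n)) 0) ≢0
coeff-X^n-m≢0 (suc n) (suc m) ≢0 = cong suc (coeff-X^n-m≢0 n m
  λ ≡0 → ≢0 (trans (coeff≗ (X*p≈0∷p (X ^ n)) (suc m)) ≡0))

-- Over the naturals nothing cancels: a nonzero coefficient must come from one of the monomials.
coeff-poly-≢0 : ∀ es n → coeff (poly es) n ≢ 0 → n ∈ es
coeff-poly-≢0 []       n ≢0 = contradiction refl ≢0
coeff-poly-≢0 (e ∷ es) n ≢0 with coeff (X ^ e) n ℕ.≟ 0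
... | no  X^e≢0 = here (coeff-X^n-m≢0 e n X^e≢0)
... | yes X^e≡0 = there (coeff-poly-≢0 es n λ es≡0 →
  ≢0 (trans (coeff-+ (X ^ e) (poly es) n) (cong₂ ℕ._+_ X^e≡0 es≡0)))

poly-↭ : ∀ {es fs} → es ↭ℕ fs → poly es ≈ poly fs
poly-↭ Perm.refl = ≈-refl
poly-↭ (Perm.prep e p) = +-cong {X ^ e} ≈-refl (poly-↭ p)
poly-↭ (Perm.swap {xs = es} {ys = fs} e f p) = begin
  X ^ e + (X ^ f + poly es)  ≈⟨ +-assoc (X ^ e) (X ^ f) (poly es) ⟨
  X ^ e + X ^ f + poly es    ≈⟨ +-cong (+-comm (X ^ e) (X ^ f)) (poly-↭ p) ⟩
  X ^ f + X ^ e + poly fs    ≈⟨ +-assoc (X ^ f) (X ^ e) (poly fs) ⟩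
  X ^ f + (X ^ e + poly fs)  ∎
  where open SetoidReasoning N₁-setoid
poly-↭ (Perm.trans p q) = ≈-trans (poly-↭ p) (poly-↭ q)

coeff-poly-head : ∀ e es → coeff (poly (e ∷ es)) e ≢ 0
coeff-poly-head e es eq = ℕ.1+n≢0 (begin
  1 ℕ.+ coeff (poly es) e                ≡⟨ cong (ℕ._+ coeff (poly es) e) (coeff-X^n-n e) ⟨
  coeff (X ^ e) e ℕ.+ coeff (poly es) e  ≡⟨ coeff-+ (X ^ e) (poly es) e ⟨
  coeff (poly (e ∷ es)) e                ≡⟨ eq ⟩
  0                                      ∎)
  where open ≡-Reasoning

-- The first exponent `e` has a nonzero coefficient on the left, hence on the right, so it occurs in
-- `fs`. Moved to the front there, `X ^ e` cancels and induction applies.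
poly-injective : ∀ es fs → poly es ≈ poly fs → es ↭ℕ fs
poly-injective []       []       eq = Perm.refl
poly-injective []       (f ∷ fs) eq =
  contradiction (sym (coeff≗ eq f)) (coeff-poly-head f fs)
poly-injective (e ∷ es) fs       eq
  with gs , hs , refl ← ∈-∃++ (coeff-poly-≢0 fs e
         (subst (_≢ 0) (coeff≗ eq e) (coeff-poly-head e es)))
  = Perm.trans
      (Perm.prep e (poly-injective es (gs ++ hs)
        (+-cancelˡ (X ^ e) (≈-trans eq (poly-↭ (Perm.shift e gs hs))))))
      (Perm.↭-sym (Perm.shift e gs hs))

length-exponents : ∀ p → length (exponents p) ≡ eval p 1
length-exponents []      = refl
length-exponents (a ∷ p) = begin
  length (replicate a 0 ++ map suc (exponents p))
    ≡⟨ List.length-++ (replicate a 0) ⟩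
  length (replicate a 0) ℕ.+ length (map suc (exponents p))
    ≡⟨ cong₂ ℕ._+_ (List.length-replicate a) (List.length-map suc (exponents p)) ⟩
  a ℕ.+ length (exponents p)
    ≡⟨ cong (a ℕ.+_) (trans (length-exponents p) (sym (ℕ.*-identityˡ _))) ⟩
  a ℕ.+ 1 ℕ.* eval p 1 ∎
  where open ≡-Reasoning

p≈poly⇒eval-1 : ∀ {p} es → p ≈ poly es → eval p 1 ≡ length es
p≈poly⇒eval-1 {p} es eq = trans (sym (length-exponents p))
  (Perm.↭-length (poly-injective (exponents p) es (≈-trans (poly-exponents p) eq)))

-- `eval` works on lists, so its invariance under `_≈_` needs a proof; at 1 it counts the exponents,
-- which are determined up to permutation.
eval-1-cong : ∀ {p q} → p ≈ q → eval p 1 ≡ eval q 1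
eval-1-cong {p} {q} p≈q = trans
  (p≈poly⇒eval-1 (exponents q) (≈-trans p≈q (≈-sym (poly-exponents q))))
  (length-exponents q)

coeff₀≢0⇒poly : ∀ p → coeff p 0 ≢ 0 →
  ∃[ es ] (p ≈ poly (0 ∷ es) × suc (length es) ≡ eval p 1)
coeff₀≢0⇒poly []          ≢0 = contradiction refl ≢0
coeff₀≢0⇒poly (zero  ∷ p) ≢0 = contradiction refl ≢0
coeff₀≢0⇒poly (suc a ∷ p) ≢0 =
  replicate a 0 ++ map suc (exponents p) ,
  ≈-sym (poly-exponents (suc a ∷ p)) , length-exponents (suc a ∷ p)

-- Binomials and trinomials

binomial : ℕ → N₁
binomial i = poly (0 ∷ i ∷ [])

trinomial : ℕ → ℕ → N₁
trinomial k l = poly (0 ∷ k ∷ l ∷ [])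

eval≡2⇒binomial : ∀ {p} → coeff p 0 ≢ 0 → eval p 1 ≡ 2 → ∃[ i ] p ≈ binomial i
eval≡2⇒binomial {p} ≢0 ≡2 with coeff₀≢0⇒poly p ≢0
... | [] , eq , len = contradiction (trans len ≡2) λ ()
... | i ∷ [] , eq , len = i , eq
... | _ ∷ _ ∷ _ , eq , len = contradiction (trans len ≡2) λ ()

-- One of the three exponents is 0; the other two are put in order, so that later the largest
-- exponent of a product is known.
eval≡3⇒trinomial : ∀ {p} → coeff p 0 ≢ 0 → eval p 1 ≡ 3 →
  ∃[ k ] ∃[ l ] (k ℕ.≤ l × p ≈ trinomial k l)
eval≡3⇒trinomial {p} ≢0 ≡3 with coeff₀≢0⇒poly p ≢0
... | [] , eq , len = contradiction (trans len ≡3) λ ()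
... | _ ∷ [] , eq , len = contradiction (trans len ≡3) λ ()
... | _ ∷ _ ∷ _ ∷ _ , eq , len = contradiction (trans len ≡3) λ ()
... | k ∷ l ∷ [] , eq , len with ℕ.≤-total k l
...   | inj₁ k≤l = k , l , k≤l , eq
...   | inj₂ l≤k = l , k , l≤k , ≈-trans eq (poly-↭ (Perm.prep 0 (Perm.swap k l (Perm.refl {xs = []}))))

productExponents : ℕ → ℕ → ℕ → List ℕ
productExponents i k l = 0 ∷ k ∷ l ∷ i ∷ i ℕ.+ k ∷ i ℕ.+ l ∷ []

binomial*trinomial : ∀ i k l →
  binomial i * trinomial k l ≈ poly (productExponents i k l)
binomial*trinomial i k l = subst
  -- The product of exponent lists contains `i + 0`, which `productExponents` writes as `i`.
  (λ e → binomial i * trinomial k l ≈ poly (0 ∷ k ∷ l ∷ e ∷ i ℕ.+ k ∷ i ℕ.+ l ∷ []))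
  (ℕ.+-identityʳ i) (poly-* (0 ∷ i ∷ []) (0 ∷ k ∷ l ∷ []))

-- The equation (1 + Xⁱ)(1 + Xᵏ + Xˡ) = (1 + Xʲ)(1 + Xᵐ + Xⁿ)

[x]↭[y]⇒x≡y : ∀ {x y : ℕ} → [ x ] ↭ℕ [ y ] → x ≡ y
[x]↭[y]⇒x≡y p with here eq ← Perm.∈-resp-↭ p (here refl) = eq

-- The heads are the minima of the two pairs, so each is at most the other; cancelling them leaves
-- the second entries.
sorted-pair-injective : ∀ {a b c d} → a ℕ.≤ b → c ℕ.≤ d →
  a ∷ b ∷ [] ↭ℕ c ∷ d ∷ [] → a ≡ c × b ≡ d
sorted-pair-injective {a} {b} {c} {d} a≤b c≤d p = a≡c , b≡d a≡c p
  where
  head-≤ : ∀ {a b c d} → c ℕ.≤ d → a ∷ b ∷ [] ↭ℕ c ∷ d ∷ [] → c ℕ.≤ a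
  head-≤ c≤d p with Perm.∈-resp-↭ p (here refl)
  ... | here refl         = ℕ.≤-refl
  ... | there (here refl) = c≤d

  a≡c : a ≡ c
  a≡c = ℕ.≤-antisym (head-≤ a≤b (Perm.↭-sym p)) (head-≤ c≤d p)

  b≡d : a ≡ c → a ∷ b ∷ [] ↭ℕ c ∷ d ∷ [] → b ≡ d
  b≡d refl p = [x]↭[y]⇒x≡y (Perm.drop-∷ p)

∈productExponents⇒≤ : ∀ {i k l e} → k ℕ.≤ l → e ∈ productExponents i k l → e ℕ.≤ i ℕ.+ l
∈productExponents⇒≤ k≤l (here refl) = z≤n
∈productExponents⇒≤ {i} k≤l (there (here refl)) = ℕ.≤-trans k≤l (ℕ.m≤n+m _ i)
∈productExponents⇒≤ {i} k≤l (there (there (here refl))) = ℕ.m≤n+m _ i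
∈productExponents⇒≤ k≤l (there (there (there (here refl)))) = ℕ.m≤m+n _ _
∈productExponents⇒≤ {i} k≤l (there (there (there (there (here refl))))) = ℕ.+-monoʳ-≤ i k≤l
∈productExponents⇒≤ k≤l (there (there (there (there (there (here refl)))))) = ℕ.≤-refl

top-≤ : ∀ {i k l j m n} → m ℕ.≤ n → productExponents i k l ↭ℕ productExponents j m n →
  i ℕ.+ l ℕ.≤ j ℕ.+ n
top-≤ m≤n p = ∈productExponents⇒≤ m≤n
  (Perm.∈-resp-↭ p (there (there (there (there (there (here refl)))))))

-- Cancels the common exponent 0 and the common largest exponent, leaving two multisets of four.
drop-bottom-top : ∀ {i k l j m n} → i ℕ.+ l ≡ j ℕ.+ n →
  productExponents i k l ↭ℕ productExponents j m n →
  k ∷ l ∷ i ∷ i ℕ.+ k ∷ [] ↭ℕ m ∷ n ∷ j ∷ j ℕ.+ m ∷ []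
drop-bottom-top {i} {k} {l} {j} {m} {n} top p =
  Perm.drop-mid (k ∷ l ∷ i ∷ i ℕ.+ k ∷ []) (m ∷ n ∷ j ∷ j ℕ.+ m ∷ [])
    (subst (λ e → k ∷ l ∷ i ∷ i ℕ.+ k ∷ i ℕ.+ l ∷ [] ↭ℕ m ∷ n ∷ j ∷ j ℕ.+ m ∷ e ∷ [])
      (sym top) (Perm.drop-∷ p))

-- Equal largest exponents give `l ≡ n`. Cancelling `l` and `i` from the four inner exponents leaves
-- the sorted pairs `k, i + k` and `m, i + m`.
productExponents-injective : ∀ {i k l m n} → k ℕ.≤ l → m ℕ.≤ n →
  productExponents i k l ↭ℕ productExponents i m n → k ≡ m × l ≡ n
productExponents-injective {i} {k} {l} {m} {n} k≤l m≤n p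
  with top ← ℕ.≤-antisym (top-≤ {i = i} m≤n p) (top-≤ {i = i} k≤l (Perm.↭-sym p))
  with refl ← ℕ.+-cancelˡ-≡ i l n top
  = proj₁ (sorted-pair-injective (ℕ.m≤n+m k i) (ℕ.m≤n+m m i)
      (Perm.drop-mid [ k ] [ m ] (Perm.drop-mid [ k ] [ m ] (drop-bottom-top {i} {j = i} top p))))
  , refl

-- Among the inner exponents, `i` has to equal one of `m`, `n`, `j`, `j + m`. Following it, then
-- `l`, then `k`, every branch but one contradicts `i < j`; the survivor is the classical identity
-- with `m = i` and `n = 2i`.
productExponents-coincidence : ∀ {i k l j m n} → k ℕ.≤ l → m ℕ.≤ n → i ℕ.< j →
  productExponents i k l ↭ℕ productExponents j m n → j ≡ 3 ℕ.* i × k ≡ 2 ℕ.* i × l ≡ 4 ℕ.* i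
productExponents-coincidence {i} {k} {l} {j} {m} {n} k≤l m≤n i<j p
  = locate-i (Perm.∈-resp-↭ inner (there (there (here refl)))) inner
  where
  Conclusion : Set
  Conclusion = j ≡ 3 ℕ.* i × k ≡ 2 ℕ.* i × l ≡ 4 ℕ.* i

  i≢j : i ≢ j
  i≢j = ℕ.<⇒≢ i<j

  top : i ℕ.+ l ≡ j ℕ.+ n
  top = ℕ.≤-antisym (top-≤ {i} m≤n p) (top-≤ {j} k≤l (Perm.↭-sym p))

  inner : k ∷ l ∷ i ∷ i ℕ.+ k ∷ [] ↭ℕ m ∷ n ∷ j ∷ j ℕ.+ m ∷ []
  inner = drop-bottom-top {i} {j = j} top p

  locate-l : m ≡ i → k ∷ l ∷ i ℕ.+ k ∷ [] ↭ℕ n ∷ j ∷ j ℕ.+ i ∷ [] →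
             l ∈ n ∷ j ∷ j ℕ.+ i ∷ [] → Conclusion
  -- If `l = n`, the equality of the largest exponents gives `i = j`.
  locate-l m≡i p (here refl) = contradiction (ℕ.+-cancelʳ-≡ l i j top) i≢j
  -- If `l = j`, the largest exponents give `n = i`. The pairs `k, i + k` and `i, j + i` then agree,
  -- so `k = i` and again `i = j`.
  locate-l m≡i p (there (here refl))
    with refl ← ℕ.+-cancelˡ-≡ l i n (trans (ℕ.+-comm l i) top)
    = contradiction (ℕ.+-cancelʳ-≡ i i l (subst (λ e → i ℕ.+ e ≡ l ℕ.+ i) k≡i i+k≡j+i)) i≢j
    where
    eqs = sorted-pair-injective (ℕ.m≤n+m k i) (ℕ.m≤n+m i l)
            (Perm.drop-mid [ k ] [ i ] p)
    k≡i = proj₁ eqs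
    i+k≡j+i = proj₂ eqs
  -- If `l = j + i`, the largest exponents give `n = 2i`, and `k, i + k` has to match `n, j`.
  locate-l m≡i p (there (there (here refl))) = locate-k n≡i+i rest (Perm.∈-resp-↭ rest (here refl))
    where
    n≡i+i : n ≡ i ℕ.+ i
    n≡i+i = ℕ.+-cancelˡ-≡ j n (i ℕ.+ i) (begin
      j ℕ.+ n          ≡⟨ top ⟨
      i ℕ.+ (j ℕ.+ i)  ≡⟨ ℕ.+-comm i (j ℕ.+ i) ⟩
      j ℕ.+ i ℕ.+ i    ≡⟨ ℕ.+-assoc j i i ⟩
      j ℕ.+ (i ℕ.+ i)  ∎)
      where open ≡-Reasoning

    rest : k ∷ i ℕ.+ k ∷ [] ↭ℕ n ∷ j ∷ []
    rest = Perm.drop-mid [ k ] (n ∷ j ∷ []) p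

    locate-k : n ≡ i ℕ.+ i → k ∷ i ℕ.+ k ∷ [] ↭ℕ n ∷ j ∷ [] → k ∈ n ∷ j ∷ [] →
      j ≡ 3 ℕ.* i × k ≡ 2 ℕ.* i × j ℕ.+ i ≡ 4 ℕ.* i
    -- The surviving branch: `k = n = 2i`, hence `j = i + k = 3i` and `l = j + i = 4i`.
    locate-k refl p (here refl) with refl ← [x]↭[y]⇒x≡y (Perm.drop-∷ p)
      = j≡3i , cong (i ℕ.+_) (sym (ℕ.+-identityʳ i))
      , trans (ℕ.+-comm _ i) (cong (i ℕ.+_) j≡3i)
      where
      j≡3i : i ℕ.+ (i ℕ.+ i) ≡ 3 ℕ.* i
      j≡3i = cong (λ e → i ℕ.+ (i ℕ.+ e)) (sym (ℕ.+-identityʳ i))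
    -- If `k = j`, then `i + k = n = 2i`, so `k = i` and `i = j`.
    locate-k refl p (there (here refl)) =
      contradiction (sym (ℕ.+-cancelˡ-≡ i k i ([x]↭[y]⇒x≡y (Perm.drop-mid [] [ n ] p)))) i≢j

  locate-i : i ∈ m ∷ n ∷ j ∷ j ℕ.+ m ∷ [] →
             k ∷ l ∷ i ∷ i ℕ.+ k ∷ [] ↭ℕ m ∷ n ∷ j ∷ j ℕ.+ m ∷ [] → Conclusion
  -- `i = m`: both cancel, and the position of `l` decides.
  locate-i (here refl) p = locate-l refl rest (Perm.∈-resp-↭ rest (there (here refl)))
    where rest = Perm.drop-mid (k ∷ l ∷ []) [] p
  -- `i = n`: the largest exponents give `l = j`. Cancelling `i` and `j` leaves `k, i + k` and
  -- `m, j + m`, so `k = m` and `i = j`.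
  locate-i (there (here refl)) p
    with refl ← ℕ.+-cancelˡ-≡ i l j (trans top (ℕ.+-comm j i))
    = contradiction
        (ℕ.+-cancelʳ-≡ k i j (subst (λ e → i ℕ.+ k ≡ j ℕ.+ e) (sym (proj₁ eqs)) (proj₂ eqs)))
        i≢j
    where
    eqs = sorted-pair-injective (ℕ.m≤n+m k i) (ℕ.m≤n+m m j)
            (Perm.drop-mid [ k ] [ m ] (Perm.drop-mid (k ∷ j ∷ []) [ m ] p))
  locate-i (there (there (here i≡j))) p = contradiction i≡j i≢j
  -- `i = j + m` would make `i` at least `j`.
  locate-i (there (there (there (here refl)))) p = contradiction i<j (ℕ.≤⇒≯ (ℕ.m≤m+n j m))

-- Factorisations

eval-+ : ∀ p q x → eval (p + q) x ≡ eval p x ℕ.+ eval q x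
eval-+ []      q       x = refl
eval-+ (a ∷ p) []      x = sym (ℕ.+-identityʳ _)
eval-+ (a ∷ p) (b ∷ q) x = begin
  a ℕ.+ b ℕ.+ x ℕ.* eval (p + q) x
    ≡⟨ cong (λ e → a ℕ.+ b ℕ.+ x ℕ.* e) (eval-+ p q x) ⟩
  a ℕ.+ b ℕ.+ x ℕ.* (eval p x ℕ.+ eval q x)
    ≡⟨ cong (a ℕ.+ b ℕ.+_) (ℕ.*-distribˡ-+ x (eval p x) (eval q x)) ⟩
  a ℕ.+ b ℕ.+ (x ℕ.* eval p x ℕ.+ x ℕ.* eval q x)
    ≡⟨ ℕ+.interchange a b (x ℕ.* eval p x) (x ℕ.* eval q x) ⟩
  a ℕ.+ x ℕ.* eval p x ℕ.+ (b ℕ.+ x ℕ.* eval q x)       ∎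
  where open ≡-Reasoning

eval-· : ∀ a p x → eval (a · p) x ≡ a ℕ.* eval p x
eval-· a []      x = sym (ℕ.*-zeroʳ a)
eval-· a (b ∷ p) x = begin
  a ℕ.* b ℕ.+ x ℕ.* eval (a · p) x      ≡⟨ cong (λ e → a ℕ.* b ℕ.+ x ℕ.* e) (eval-· a p x) ⟩
  a ℕ.* b ℕ.+ x ℕ.* (a ℕ.* eval p x)    ≡⟨ cong (a ℕ.* b ℕ.+_) (ℕ*.x∙yz≈y∙xz x a (eval p x)) ⟩
  a ℕ.* b ℕ.+ a ℕ.* (x ℕ.* eval p x)    ≡⟨ ℕ.*-distribˡ-+ a b (x ℕ.* eval p x) ⟨
  a ℕ.* (b ℕ.+ x ℕ.* eval p x)          ∎
  where open ≡-Reasoning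

eval-* : ∀ p q x → eval (p * q) x ≡ eval p x ℕ.* eval q x
eval-* []      q x = refl
eval-* (a ∷ p) q x = begin
  eval (a · q + (0 ∷ p * q)) x                        ≡⟨ eval-+ (a · q) (0 ∷ p * q) x ⟩
  eval (a · q) x ℕ.+ x ℕ.* eval (p * q) x
    ≡⟨ cong₂ (λ e f → e ℕ.+ x ℕ.* f) (eval-· a q x) (eval-* p q x) ⟩
  a ℕ.* eval q x ℕ.+ x ℕ.* (eval p x ℕ.* eval q x)
    ≡⟨ cong (a ℕ.* eval q x ℕ.+_) (ℕ.*-assoc x (eval p x) (eval q x)) ⟨
  a ℕ.* eval q x ℕ.+ x ℕ.* eval p x ℕ.* eval q x
    ≡⟨ ℕ.*-distribʳ-+ (eval q x) a (x ℕ.* eval p x) ⟨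
  (a ℕ.+ x ℕ.* eval p x) ℕ.* eval q x                 ∎
  where open ≡-Reasoning

coeff₀-* : ∀ p q → coeff (p * q) 0 ≡ coeff p 0 ℕ.* coeff q 0
coeff₀-* []      q = refl
coeff₀-* (a ∷ p) q = begin
  coeff (a · q + (0 ∷ p * q)) 0   ≡⟨ coeff-+ (a · q) (0 ∷ p * q) 0 ⟩
  coeff (a · q) 0 ℕ.+ 0           ≡⟨ ℕ.+-identityʳ _ ⟩
  coeff (a · q) 0                 ≡⟨ coeff-· a q 0 ⟩
  a ℕ.* coeff q 0                 ∎
  where open ≡-Reasoning

coeff₀-*-≢0 : ∀ p q → coeff (p * q) 0 ≢ 0 → coeff p 0 ≢ 0 × coeff q 0 ≢ 0
coeff₀-*-≢0 p q ≢0 =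
  (λ p≡0 → ≢0 (trans (coeff₀-* p q) (cong (ℕ._* coeff q 0) p≡0))) ,
  (λ q≡0 → ≢0 (trans (coeff₀-* p q) (trans (cong (coeff p 0 ℕ.*_) q≡0) (ℕ.*-zeroʳ (coeff p 0)))))

coeff₀≢0⇒1≤eval : ∀ p x → coeff p 0 ≢ 0 → 1 ℕ.≤ eval p x
coeff₀≢0⇒1≤eval []      x ≢0 = contradiction refl ≢0
coeff₀≢0⇒1≤eval (a ∷ p) x ≢0 = ℕ.≤-trans (ℕ.n≢0⇒n>0 ≢0) (ℕ.m≤m+n a _)

-- With 0 among the exponents, a single monomial would be the polynomial 1, which is not
-- irreducible.
irreducible⇒2≤eval-1 : ∀ {p} → Irreducible p → coeff p 0 ≢ 0 → 2 ℕ.≤ eval p 1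
irreducible⇒2≤eval-1 {p} (_ , p≉1 , _) ≢0 with coeff₀≢0⇒poly p ≢0
... | []    , eq , len = contradiction eq p≉1
... | _ ∷ _ , eq , len = subst (2 ℕ.≤_) len (s≤s (s≤s z≤n))

-- A vanishing constant coefficient exhibits the polynomial as `X` times another; as `X` is not 1,
-- the cofactor is.
irreducible∧coeff₀≡0⇒≈X : ∀ {p} → Irreducible p → coeff p 0 ≡ 0 → p ≈ X
irreducible∧coeff₀≡0⇒≈X {[]}    (p≉0 , _) _ = contradiction ≈-refl p≉0
irreducible∧coeff₀≡0⇒≈X {0 ∷ p} (_ , _ , split) refl with split X p (≈-sym (X*p≈0∷p p))
... | inj₁ X≈1 = contradiction (coeff≗ X≈1 0) λ ()
... | inj₂ p≈1 = ∷-cong refl p≈1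

-- Splitting off the factor X

product-↭ : ∀ {Qs Rs} → Qs ↭ Rs → product Qs ≈ product Rs
product-↭ = SetoidPerm.foldr-commMonoid N₁-setoid *-isCommutativeMonoid

-- X is prime, because the constant coefficient is multiplicative.
extract-X : ∀ Qs → All Irreducible Qs → coeff (product Qs) 0 ≡ 0 →
  ∃[ Qs′ ] (All Irreducible Qs′ × Qs ↭ X ∷ Qs′)
extract-X []       _              ()
extract-X (Q ∷ Qs) (irrQ ∷ irrQs) ≡0
  with ℕ.m*n≡0⇒m≡0∨n≡0 (coeff Q 0) (trans (sym (coeff₀-* Q (product Qs))) ≡0)
... | inj₁ Q≡0 = Qs , irrQs ,
  SetoidPerm.prep (irreducible∧coeff₀≡0⇒≈X irrQ Q≡0) (SetoidPerm.↭-refl N₁-setoid)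
... | inj₂ Qs≡0 with Qs′ , irrQs′ , Qs↭ ← extract-X Qs irrQs Qs≡0 = Q ∷ Qs′ , irrQ ∷ irrQs′ ,
  SetoidPerm.↭-trans N₁-setoid
    (SetoidPerm.↭-prep N₁-setoid Q Qs↭)
    (SetoidPerm.↭-swap N₁-setoid Q X (SetoidPerm.↭-refl N₁-setoid))

strip-X : ∀ {p} Qs → IsFactorisation (0 ∷ p) Qs →
  ∃[ Qs′ ] (IsFactorisation p Qs′ × Qs ↭ X ∷ Qs′)
strip-X {p} Qs (irrQs , eq) with Qs′ , irrQs′ , Qs↭ ← extract-X Qs irrQs (sym (coeff≗ eq 0)) =
  Qs′ , (irrQs′ , ∷-injectiveʳ (≈-trans eq (≈-trans (product-↭ Qs↭) (X*p≈0∷p (product Qs′))))) , Qs↭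

-- Every factorisation of X times `p` contains `X`; removing it from two of them leaves two
-- factorisations of `p`.
uniqueFactorisation-0∷ : ∀ {p} → HasUniqueFactorisation p → HasUniqueFactorisation (0 ∷ p)
uniqueFactorisation-0∷ unique Qs Rs facQs facRs
  with Qs′ , facQs′ , Qs↭ ← strip-X Qs facQs
     | Rs′ , facRs′ , Rs↭ ← strip-X Rs facRs
  = begin
    Qs       ↭⟨ Qs↭ ⟩
    X ∷ Qs′  ↭⟨ SetoidPerm.↭-prep N₁-setoid X (unique Qs′ Rs′ facQs′ facRs′) ⟩
    X ∷ Rs′  ↭⟨ Rs↭ ⟨
    Rs       ∎
  where open SetoidPerm.PermutationReasoning N₁-setoid

-- The possible shapes of a factorisation

m*n≡6 : ∀ m n → 2 ℕ.≤ m → 2 ℕ.≤ n → m ℕ.* n ≡ 6 → (m ≡ 2 × n ≡ 3) ⊎ (m ≡ 3 × n ≡ 2)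
m*n≡6 (suc zero) n (s≤s ())
m*n≡6 2 n _ _ eq = inj₁ (refl , ℕ.*-cancelˡ-≡ n 3 2 eq)
m*n≡6 3 n _ _ eq = inj₂ (refl , ℕ.*-cancelˡ-≡ n 2 3 eq)
-- With `m` at least 4 and `n` at least 2 the product is at least 8.
m*n≡6 (suc (suc (suc (suc m)))) n _ 2≤n eq = contradiction (subst (8 ℕ.≤_) eq
  (ℕ.*-mono-≤ {4} {4 ℕ.+ m} (s≤s (s≤s (s≤s (s≤s z≤n)))) 2≤n)) λ { (s≤s (s≤s (s≤s (s≤s (s≤s (s≤s ())))))) }

-- In `pair` the permutation absorbs the order of the two factors, and `k ≤ l` fixes the names of
-- the exponents.
data Shape (Qs : List N₁) : Set where
  single : ∀ Q → Irreducible Q → Qs ≡ [ Q ] → Shape Qs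
  pair   : ∀ i k l → k ℕ.≤ l → Qs ↭ binomial i ∷ trinomial k l ∷ [] → Shape Qs

-- All factors inherit a nonzero constant coefficient, so each has value at least 2 at 1. As these
-- values multiply to 6, there is one factor, or there are two with values 2 and 3.
shape : ∀ Qs → All Irreducible Qs → coeff (product Qs) 0 ≢ 0 → eval (product Qs) 1 ≡ 6 → Shape Qs
shape []       _          _  ()
shape (A ∷ []) (irrA ∷ _) _  _ = single A irrA refl
shape (A ∷ B ∷ []) (irrA ∷ irrB ∷ []) ≢0 ≡6
  with coeff₀-*-≢0 A (product [ B ]) ≢0
... | A≢0 , B*1≢0
  with B≢0 ← proj₁ (coeff₀-*-≢0 B 1# B*1≢0)
  with m*n≡6 (eval A 1) (eval B 1)
         (irreducible⇒2≤eval-1 irrA A≢0) (irreducible⇒2≤eval-1 irrB B≢0)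
         (trans (sym (eval-* A B 1)) (trans (eval-1-cong (*-congˡ A (≈-sym product-[ B ]))) ≡6))
... | inj₁ (A≡2 , B≡3)
  with i , A≈ ← eval≡2⇒binomial A≢0 A≡2
     | k , l , k≤l , B≈ ← eval≡3⇒trinomial B≢0 B≡3
  = pair i k l k≤l (SetoidPerm.prep A≈ (SetoidPerm.prep B≈ (SetoidPerm.↭-refl N₁-setoid)))
... | inj₂ (A≡3 , B≡2)
  with i , B≈ ← eval≡2⇒binomial B≢0 B≡2
     | k , l , k≤l , A≈ ← eval≡3⇒trinomial A≢0 A≡3
  = pair i k l k≤l (SetoidPerm.swap A≈ B≈ (SetoidPerm.↭-refl N₁-setoid))
shape (A ∷ B ∷ C ∷ Ds) (irrA ∷ irrB ∷ irrC ∷ _) ≢0 ≡6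
  with A≢0 , BCD≢0 ← coeff₀-*-≢0 A (product (B ∷ C ∷ Ds)) ≢0
  with B≢0 , CD≢0 ← coeff₀-*-≢0 B (product (C ∷ Ds)) BCD≢0
  with C≢0 , D≢0 ← coeff₀-*-≢0 C (product Ds) CD≢0
  = contradiction 8≤6 λ { (s≤s (s≤s (s≤s (s≤s (s≤s (s≤s ())))))) }
  where
  2*≤ : ∀ Q R {n} → Irreducible Q → coeff Q 0 ≢ 0 → n ℕ.≤ eval R 1 → 2 ℕ.* n ℕ.≤ eval (Q * R) 1
  2*≤ Q R irrQ Q≢0 n≤ = subst (_ ℕ.≤_) (sym (eval-* Q R 1))
    (ℕ.*-mono-≤ (irreducible⇒2≤eval-1 irrQ Q≢0) n≤)

  -- Three factors contribute at least 2 each, and the product of the remaining ones at least 1.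
  8≤6 : 8 ℕ.≤ 6
  8≤6 = subst (8 ℕ.≤_) ≡6
    (2*≤ A (product (B ∷ C ∷ Ds)) irrA A≢0
      (2*≤ B (product (C ∷ Ds)) irrB B≢0
        (2*≤ C (product Ds) irrC C≢0 (coeff₀≢0⇒1≤eval (product Ds) 1 D≢0))))

-- Neither factor is 1, since they have two and three exponents where 1 has one.
irreducible≉binomial*trinomial : ∀ {Q i k l} → Irreducible Q → ¬ (Q ≈ binomial i * trinomial k l)
irreducible≉binomial*trinomial {Q} {i} {k} {l} (_ , _ , split) eq
  with split (binomial i) (trinomial k l) eq
... | inj₁ ≈1 = contradiction (Perm.↭-length (poly-injective (0 ∷ i ∷ []) [ 0 ] ≈1)) λ ()
... | inj₂ ≈1 = contradiction (Perm.↭-length (poly-injective (0 ∷ k ∷ l ∷ []) [ 0 ] ≈1)) λ ()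

-- Progressions and uniqueness

progression : ℕ → N₁
progression b = 1# + X ^ b + X ^ (2 ℕ.* b) + X ^ (3 ℕ.* b) + X ^ (4 ℕ.* b) + X ^ (5 ℕ.* b)

IsProgression : N₁ → ℕ → Set
IsProgression P b = 1 ℕ.≤ b × P ≈ progression b

progression≈poly : ∀ b → progression b ≈
  poly (0 ∷ b ∷ 2 ℕ.* b ∷ 3 ℕ.* b ∷ 4 ℕ.* b ∷ 5 ℕ.* b ∷ [])
progression≈poly b = begin
  p₄ + X ^ (5 ℕ.* b)  ≈⟨ +-cong {p₄} ≈-refl (+-identityʳ (X ^ (5 ℕ.* b))) ⟨
  p₄ + poly e₅        ≈⟨ +-assoc p₃ (X ^ (4 ℕ.* b)) (poly e₅) ⟩
  p₃ + poly e₄        ≈⟨ +-assoc p₂ (X ^ (3 ℕ.* b)) (poly e₄) ⟩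
  p₂ + poly e₃        ≈⟨ +-assoc p₁ (X ^ (2 ℕ.* b)) (poly e₃) ⟩
  p₁ + poly e₂        ≈⟨ +-assoc 1# (X ^ b) (poly e₂) ⟩
  poly (0 ∷ b ∷ e₂)   ∎
  where
  open SetoidReasoning N₁-setoid
  open CommutativeSemiring N₁-commutativeSemiring using (+-identityʳ)
  p₁ = 1# + X ^ b
  p₂ = p₁ + X ^ (2 ℕ.* b)
  p₃ = p₂ + X ^ (3 ℕ.* b)
  p₄ = p₃ + X ^ (4 ℕ.* b)
  e₅ = [ 5 ℕ.* b ]
  e₄ = 4 ℕ.* b ∷ e₅
  e₃ = 3 ℕ.* b ∷ e₄
  e₂ = 2 ℕ.* b ∷ e₃

coincidence⇒progression : ∀ i → binomial i * trinomial (2 ℕ.* i) (4 ℕ.* i) ≈ progression i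
coincidence⇒progression i = begin
  binomial i * trinomial 2i 4i
    ≈⟨ binomial*trinomial i 2i 4i ⟩
  -- `i + 2i` and `i + 4i` compute to `3i` and `5i`; sorting the exponents remains.
  poly (0 ∷ 2i ∷ 4i ∷ i ∷ 3i ∷ 5i ∷ [])
    ≈⟨ poly-↭ (Perm.prep 0 (Perm.shift i (2i ∷ 4i ∷ []) (3i ∷ 5i ∷ []))) ⟩
  poly (0 ∷ i ∷ 2i ∷ 4i ∷ 3i ∷ 5i ∷ [])
    ≈⟨ poly-↭ (Perm.++⁺ˡ (0 ∷ i ∷ 2i ∷ []) (Perm.swap 4i 3i (Perm.refl {xs = [ 5i ]}))) ⟩
  poly (0 ∷ i ∷ 2i ∷ 3i ∷ 4i ∷ 5i ∷ [])
    ≈⟨ progression≈poly i ⟨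
  progression i ∎
  where
  open SetoidReasoning N₁-setoid
  2i = 2 ℕ.* i
  3i = 3 ℕ.* i
  4i = 4 ℕ.* i
  5i = 5 ℕ.* i

-- A progression's difference is one of its exponents, which bounds the search.
progression? : ∀ P → Dec (∃[ b ] IsProgression P b)
progression? P = map′ satisfied
  (λ { (b , 1≤b , eq) → lose (difference∈exponents eq) (1≤b , eq) })
  (any? (λ b → (1 ℕ.≤? b) ×-dec (P ≈? progression b)) (exponents P))
  where
  difference∈exponents : ∀ {b} → P ≈ progression b → b ∈ exponents P
  difference∈exponents {b} eq = Perm.∈-resp-↭
    (Perm.↭-sym (poly-injective (exponents P) (0 ∷ b ∷ 2 ℕ.* b ∷ 3 ℕ.* b ∷ 4 ℕ.* b ∷ 5 ℕ.* b ∷ [])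
      (≈-trans (poly-exponents P) (≈-trans eq (progression≈poly b)))))
    (there (here refl))

-- If `i` and `j` differ, the product with the smaller one is a progression by the coincidence
-- lemma; if they agree, the remaining exponents are determined.
pairs-unique : ∀ {P i k l j m n} → k ℕ.≤ l → m ℕ.≤ n → ¬ (∃[ b ] IsProgression P b) →
  P ≈ binomial i * trinomial k l → P ≈ binomial j * trinomial m n → i ≡ j × k ≡ m × l ≡ n
pairs-unique {P} {i} {k} {l} {j} {m} {n} k≤l m≤n ¬prog P≈ P≈′ = compare (ℕ.<-cmp i j)
  where
  exponents↭ : productExponents i k l ↭ℕ productExponents j m n
  exponents↭ = poly-injective (productExponents i k l) (productExponents j m n) (begin
    poly (productExponents i k l)  ≈⟨ binomial*trinomial i k l ⟨
    binomial i * trinomial k l     ≈⟨ P≈ ⟨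
    P                              ≈⟨ P≈′ ⟩
    binomial j * trinomial m n     ≈⟨ binomial*trinomial j m n ⟩
    poly (productExponents j m n)  ∎)
    where open SetoidReasoning N₁-setoid

  no-coincidence : ∀ {i k l j} → i ℕ.< j → P ≈ binomial i * trinomial k l →
    ¬ (j ≡ 3 ℕ.* i × k ≡ 2 ℕ.* i × l ≡ 4 ℕ.* i)
  -- `i = 0` would give `j = 3i = 0`, against `i < j`; so the difference `i` of the progression is
  -- positive.
  no-coincidence {zero}  ()  _    (refl , _)
  no-coincidence {suc i} i<j P≈ (refl , refl , refl) =
    ¬prog (suc i , s≤s z≤n , ≈-trans P≈ (coincidence⇒progression (suc i)))

  compare : Tri (i ℕ.< j) (i ≡ j) (j ℕ.< i) → i ≡ j × k ≡ m × l ≡ n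
  compare (tri≈ _ refl _) = refl , productExponents-injective {i} k≤l m≤n exponents↭
  compare (tri< i<j _ _)  = contradiction
    (productExponents-coincidence k≤l m≤n i<j exponents↭) (no-coincidence i<j P≈)
  compare (tri> _ _ j<i)  = contradiction
    (productExponents-coincidence m≤n k≤l j<i (Perm.↭-sym exponents↭)) (no-coincidence j<i P≈′)

¬progression⇒unique : ∀ P → coeff P 0 ≢ 0 → eval P 1 ≡ 6 →
  ¬ (∃[ b ] IsProgression P b) → HasUniqueFactorisation P
¬progression⇒unique P P≢0 P≡6 ¬prog Qs Rs (irrQs , P≈Qs) (irrRs , P≈Rs) =
  compare (shape′ Qs irrQs P≈Qs) (shape′ Rs irrRs P≈Rs)
  where
  shape′ : ∀ Qs → All Irreducible Qs → P ≈ product Qs → Shape Qs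
  shape′ Qs irrQs P≈ = shape Qs irrQs
    (subst (_≢ 0) (coeff≗ P≈ 0) P≢0) (trans (sym (eval-1-cong P≈)) P≡6)

  P≈single : ∀ {Q Qs} → P ≈ product Qs → Qs ≡ [ Q ] → P ≈ Q
  P≈single {Q} P≈ refl = ≈-trans P≈ product-[ Q ]

  P≈pair : ∀ {A B Qs} → P ≈ product Qs → Qs ↭ A ∷ B ∷ [] → P ≈ A * B
  P≈pair {A} {B} P≈ Qs↭ = ≈-trans P≈ (≈-trans (product-↭ Qs↭) (*-congˡ A product-[ B ]))

  compare : Shape Qs → Shape Rs → Qs ↭ Rs
  compare (single Q _ refl) (single R _ refl) =
    SetoidPerm.prep (≈-trans (≈-sym (P≈single P≈Qs refl)) (P≈single P≈Rs refl))
      (SetoidPerm.↭-refl N₁-setoid)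
  -- Mixed shapes would split an irreducible polynomial into a binomial and a trinomial.
  compare (single Q irrQ Qs≡) (pair i k l _ Rs↭) = contradiction
    (≈-trans (≈-sym (P≈single P≈Qs Qs≡)) (P≈pair P≈Rs Rs↭))
    (irreducible≉binomial*trinomial {i = i} {k} {l} irrQ)
  compare (pair i k l _ Qs↭) (single R irrR Rs≡) = contradiction
    (≈-trans (≈-sym (P≈single P≈Rs Rs≡)) (P≈pair P≈Qs Qs↭))
    (irreducible≉binomial*trinomial {i = i} {k} {l} irrR)
  compare (pair i k l k≤l Qs↭) (pair j m n m≤n Rs↭)
    with refl , refl , refl ← pairs-unique {P} {i} {k} {l} {j} {m} {n} k≤l m≤n ¬prog
           (P≈pair P≈Qs Qs↭) (P≈pair P≈Rs Rs↭)
    = SetoidPerm.↭-trans N₁-setoid Qs↭ (SetoidPerm.↭-sym N₁-setoid Rs↭)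

mainTheorem9 : (P : N₁) → eval P 1 ≡ 6 → ¬ HasUniqueFactorisation P →
    ∃[ a ] ∃[ b ] (1 ℕ.≤ b ×
    P ≈ X ^ a * (1# + X ^ b + X ^ (2 ℕ.* b) + X ^ (3 ℕ.* b) + X ^ (4 ℕ.* b) + X ^ (5 ℕ.* b)))
mainTheorem9 []          ()  _
-- A leading zero is a factor X. Non-uniqueness descends to `p` by the contrapositive of
-- `uniqueFactorisation-0∷`, and the exponent `a` grows by one.
mainTheorem9 (zero ∷ p)  P≡6 ¬unique
  with a , b , 1≤b , p≈ ← mainTheorem9 p (trans (sym (ℕ.*-identityˡ _)) P≡6)
         (λ unique → ¬unique (uniqueFactorisation-0∷ unique))
  = suc a , b , 1≤b , (begin
    0 ∷ p                          ≈⟨ X*p≈0∷p p ⟨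
    X * p                          ≈⟨ *-congˡ X p≈ ⟩
    X * (X ^ a * progression b)    ≈⟨ *-assoc X (X ^ a) (progression b) ⟨
    X ^ suc a * progression b      ∎)
  where open SetoidReasoning N₁-setoid
-- The constant coefficient is nonzero, so `a = 0`; deciding whether `P` is a progression replaces a
-- proof by contradiction.
mainTheorem9 P@(suc _ ∷ _) P≡6 ¬unique with progression? P
... | yes (b , 1≤b , P≈) = 0 , b , 1≤b , ≈-trans P≈ (≈-sym (*-identityˡ (progression b)))
... | no  ¬prog          = contradiction (¬progression⇒unique P (λ ()) P≡6 ¬prog) ¬unique
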